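{- Let $\mathcal{M}$ be a unitary magma and $B$, $E$, and $D$ be three subsets of $\mathcal{M}$. If $\mathbb{1}_{\mathcal{M}}\in B$, $\mathbb{1}_{\mathcal{M}}\in D$, and $E\star B\subseteq D$, then $\mathsf{Lab}_{B,E,D}\mathcal{M}$ is a suboperad of $\mathsf{C}\mathcal{M}$.
   Context: Let $\mathbb{K}$ be a field of characteristic zero and $[n]=\{1,\dots,n\}$. A unitary magma is a set $\mathcal{M}$ with a binary operation $\star$ (not assumed associative) having a two-sided unit $\mathbb{1}_{\mathcal{M}}$. Operads are nonsymmetric operads in $\mathbb{K}$-vector spaces (graded from arity $1$, with partial compositions $\circ_i$ and a unit of arity $1$). A suboperad is a graded subspace containing the unit and closed under all partial compositions. An $\mathcal{M}$-clique of arity $n\ge1$ is a map $\mathfrak{p}$ assigning a label $\mathfrak{p}(x,y)\in\mathcal{M}$ to each arc $(x,y)$, $1\le x<y\le n+1$; by convention the only $\mathcal{M}$-clique of arity $1$ is $\mathbf{u}$, with $\mathbf{u}(1,2)=\mathbb{1}_{\mathcal{M}}$. The arc $(1,n+1)$ is the base; the arcs $(x,x+1)$ different from $(1,n+1)$ are the edges; all other arcs are diagonals. Write $\mathfrak{p}_0:=\mathfrak{p}(1,n+1)$ and $\mathfrak{p}_i:=\mathfrak{p}(i,i+1)$ for $i\in[n]$. $\mathsf{C}\mathcal{M}$ is the operad (with unit $\mathbf{u}$) such that $\mathsf{C}\mathcal{M}(n)$ has basis the $\mathcal{M}$-cliques of arity $n$, and for $\mathcal{M}$-cliques $\mathfrak{p},\mathfrak{q}$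 of arities $n,m$ and $i\in[n]$, $\mathfrak{p}\circ_i\mathfrak{q}$ is the $\mathcal{M}$-clique of arity $n+m-1$ with, for $1\le x<y\le n+m$, $$(\mathfrak{p}\circ_i\mathfrak{q})(x,y)=\begin{cases}\mathfrak{p}(x,y)&\text{if }y\le i,\\ \mathfrak{p}(x,y-m+1)&\text{if }x\le i<i+m\le y,\ (x,y)\ne(i,i+m),\\ \mathfrak{p}(x-m+1,y-m+1)&\text{if }i+m\le x,\\ \mathfrak{q}(x-i+1,y-i+1)&\text{if }i\le x<y\le i+m,\ (x,y)\ne(i,i+m),\\ \mathfrak{p}_i\star\mathfrak{q}_0&\text{if }(x,y)=(i,i+m),\\ \mathbb{1}_{\mathcal{M}}&\text{otherwise}.\end{cases}$$ For $X,Y\subseteq\mathcal{M}$, $X\star Y=\{x\star y:x\in X,y\in Y\}$. $\mathsf{Lab}_{B,E,D}\mathcal{M}$ is the subspace of $\mathsf{C}\mathcal{M}$ spanned by all $\mathcal{M}$-cliques whose base is labeled by an element of $B$, whose edges are all labeled by elements of $E$, and whose diagonals are all labeled by elements of $D$. -}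

module Defs where

open import Level using (Level; _⊔_) renaming (suc to lsuc)
open import Algebra.Apartness.Bundles using (HeytingField; HeytingCommutativeRing)
open import Algebra.Bundles using (CommutativeRing; UnitalMagma)
open import Algebra.Module.Bundles using (Module)
open import Algebra.Module.Structures.Biased using (IsModuleFromLeft)
open import Data.Fin.Base using (Fin; zero; toℕ)
open import Data.Fin.Properties using (toℕ<n)
open import Data.List.Base using (List; foldr)
open import Data.List.Relation.Unary.All using (All)
open import Data.Nat.Base using (ℕ; zero; suc; _+_; _∸_; _≤_; _<_; z≤n; s≤s)
open import Data.Nat.Properties
open import Data.Product.Base using (_×_; _,_; ∃-syntax; proj₁; proj₂)
open import Function.Base using (_∘_)
open import Relation.Binary.Bundles using (Setoid)
open import Relation.Binary.PropositionalEquality as ≡ using (_≡_)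
open import Relation.Nullary.Decidable.Core using (yes; no; _×-dec_)
open import Relation.Nullary.Negation.Core using (¬_)
open import Relation.Unary using (Pred; _∈_)

private
  variable
    c ℓ ℓ# a ℓa b ℓb e d m ℓm s : Level

commutativeRing : HeytingField c ℓ ℓ# → CommutativeRing c ℓ
commutativeRing K = HeytingCommutativeRing.commutativeRing (HeytingField.heytingCommutativeRing K)

CharacteristicZero : HeytingField c ℓ ℓ# → Set ℓ
CharacteristicZero K = ∀ n → n ×ᴷ 1# ≈ 0# → n ≡ 0
  where
  open CommutativeRing (commutativeRing K) using (_≈_; 0#; 1#; +-rawMonoid)
  open import Algebra.Definitions.RawMonoid +-rawMonoid using () renaming (_×_ to _×ᴷ_)

module _ {R : CommutativeRing c ℓ} (V : Module R m ℓm) where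
  open CommutativeRing R using () renaming (Carrier to Scalar)
  open Module V

  record IsSubspace (P : Pred Carrierᴹ s) : Set (c ⊔ m ⊔ ℓm ⊔ s) where
    field
      resp-≈   : ∀ {u v} → u ≈ᴹ v → u ∈ P → v ∈ P
      0-closed : 0ᴹ ∈ P
      +-closed : ∀ {u v} → u ∈ P → v ∈ P → u +ᴹ v ∈ P
      *-closed : ∀ r {v} → v ∈ P → r *ₗ v ∈ P

  linearCombination : List (Scalar × Carrierᴹ) → Carrierᴹ
  linearCombination = foldr (λ (r , v) w → r *ₗ v +ᴹ w) 0ᴹ

  Span : Pred Carrierᴹ s → Pred Carrierᴹ (c ⊔ m ⊔ ℓm ⊔ s)
  Span S v = ∃[ ts ] All (λ t → proj₂ t ∈ S) ts × v ≈ᴹ linearCombination ts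

-- The free module with basis the setoid A: formal linear expressions,
-- modulo the least congruence that imposes the module laws and is compatible
-- with the equality of A.

module Free (R : CommutativeRing c ℓ) (A : Setoid a ℓa) where
  open CommutativeRing R using (0#; 1#)
    renaming (Carrier to Scalar; _≈_ to _≈ˢ_; _+_ to _+ˢ_; _*_ to _*ˢ_; -_ to -ˢ_)
  private
    module R = CommutativeRing R
    module A = Setoid A

  infixl 6 _⊕_
  infixr 7 _⊙_
  infix  4 _≋_

  data Expr : Set (c ⊔ a) where
    basis : A.Carrier → Expr
    𝟘     : Expr
    _⊕_   : Expr → Expr → Expr
    _⊙_   : Scalar → Expr → Expr

  data _≋_ : Expr → Expr → Set (c ⊔ ℓ ⊔ a ⊔ ℓa) where
    basis-cong  : ∀ {x y} → x A.≈ y → basis x ≋ basis y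
    ≋-refl      : ∀ {u} → u ≋ u
    ≋-sym       : ∀ {u v} → u ≋ v → v ≋ u
    ≋-trans     : ∀ {u v w} → u ≋ v → v ≋ w → u ≋ w
    ⊕-cong      : ∀ {u u′ v v′} → u ≋ u′ → v ≋ v′ → u ⊕ v ≋ u′ ⊕ v′
    ⊕-assoc     : ∀ u v w → (u ⊕ v) ⊕ w ≋ u ⊕ (v ⊕ w)
    ⊕-comm      : ∀ u v → u ⊕ v ≋ v ⊕ u
    ⊕-identityˡ : ∀ u → 𝟘 ⊕ u ≋ u
    ⊙-cong      : ∀ {r r′ u u′} → r ≈ˢ r′ → u ≋ u′ → r ⊙ u ≋ r′ ⊙ u′
    ⊙-zeroˡ     : ∀ u → 0# ⊙ u ≋ 𝟘
    ⊙-zeroʳ     : ∀ r → r ⊙ 𝟘 ≋ 𝟘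
    ⊙-identity  : ∀ u → 1# ⊙ u ≋ u
    ⊙-assoc     : ∀ r r′ u → (r *ˢ r′) ⊙ u ≋ r ⊙ (r′ ⊙ u)
    ⊙-distribˡ  : ∀ r u v → r ⊙ (u ⊕ v) ≋ r ⊙ u ⊕ r ⊙ v
    ⊙-distribʳ  : ∀ u r r′ → (r +ˢ r′) ⊙ u ≋ r ⊙ u ⊕ r′ ⊙ u

  ⊖_ : Expr → Expr
  ⊖ u = (-ˢ 1#) ⊙ u

  ⊖-inverseˡ : ∀ u → ⊖ u ⊕ u ≋ 𝟘
  ⊖-inverseˡ u =
    ≋-trans (⊕-cong ≋-refl (≋-sym (⊙-identity u)))
    (≋-trans (≋-sym (⊙-distribʳ u (-ˢ 1#) 1#))
    (≋-trans (⊙-cong (R.-‿inverseˡ 1#) ≋-refl) (⊙-zeroˡ u)))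

  freeModule : Module R (c ⊔ a) (c ⊔ ℓ ⊔ a ⊔ ℓa)
  freeModule = record
    { _≈ᴹ_     = _≋_
    ; _+ᴹ_     = _⊕_
    ; _*ₗ_     = _⊙_
    ; 0ᴹ       = 𝟘
    ; -ᴹ_      = ⊖_
    ; isModule = IsModuleFromLeft.isModule {commutativeRing = R} record
      { isLeftModule = record
        { isLeftSemimodule = record
          { +ᴹ-isCommutativeMonoid = record
            { isMonoid = record
              { isSemigroup = record
                { isMagma = record
                  { isEquivalence = record { refl = ≋-refl ; sym = ≋-sym ; trans = ≋-trans }
                  ; ∙-cong = ⊕-cong
                  }
                ; assoc = ⊕-assoc
                }
              ; identity = ⊕-identityˡ , λ u → ≋-trans (⊕-comm u 𝟘) (⊕-identityˡ u)
              }
            ; comm = ⊕-comm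
            }
          ; isPreleftSemimodule = record
            { *ₗ-cong      = ⊙-cong
            ; *ₗ-zeroˡ     = ⊙-zeroˡ
            ; *ₗ-distribʳ  = ⊙-distribʳ
            ; *ₗ-identityˡ = ⊙-identity
            ; *ₗ-assoc     = ⊙-assoc
            ; *ₗ-zeroʳ     = ⊙-zeroʳ
            ; *ₗ-distribˡ  = ⊙-distribˡ
            }
          }
        ; -ᴹ‿cong    = ⊙-cong R.refl
        ; -ᴹ‿inverse = ⊖-inverseˡ , λ u → ≋-trans (⊕-comm u (⊖ u)) (⊖-inverseˡ u)
        }
      }
    }

  module _ (V : Module R m ℓm) (f : A.Carrier → Module.Carrierᴹ V) where
    private module V = Module V

    extend : Expr → V.Carrierᴹ
    extend (basis x) = f x
    extend 𝟘         = V.0ᴹ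
    extend (u ⊕ v)   = extend u V.+ᴹ extend v
    extend (r ⊙ u)   = r V.*ₗ extend u

    extend-cong : (∀ {x y} → x A.≈ y → f x V.≈ᴹ f y) → ∀ {u v} → u ≋ v → extend u V.≈ᴹ extend v
    extend-cong f-cong = go
      where
      go : ∀ {u v} → u ≋ v → extend u V.≈ᴹ extend v
      go (basis-cong x≈y)    = f-cong x≈y
      go ≋-refl              = V.≈ᴹ-refl
      go (≋-sym p)           = V.≈ᴹ-sym (go p)
      go (≋-trans p q)       = V.≈ᴹ-trans (go p) (go q)
      go (⊕-cong p q)        = V.+ᴹ-cong (go p) (go q)
      go (⊕-assoc _ _ _)     = V.+ᴹ-assoc _ _ _
      go (⊕-comm _ _)        = V.+ᴹ-comm _ _
      go (⊕-identityˡ _)     = V.+ᴹ-identityˡ _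
      go (⊙-cong r p)        = V.*ₗ-cong r (go p)
      go (⊙-zeroˡ _)         = V.*ₗ-zeroˡ _
      go (⊙-zeroʳ _)         = V.*ₗ-zeroʳ _
      go (⊙-identity _)      = V.*ₗ-identityˡ _
      go (⊙-assoc _ _ _)     = V.*ₗ-assoc _ _ _
      go (⊙-distribˡ _ _ _)  = V.*ₗ-distribˡ _ _ _
      go (⊙-distribʳ _ _ _)  = V.*ₗ-distribʳ _ _ _

module Bilinear
  (R : CommutativeRing c ℓ) (A : Setoid a ℓa) (B : Setoid b ℓb) (V : Module R m ℓm)
  (f : Setoid.Carrier A → Setoid.Carrier B → Module.Carrierᴹ V)
  where
  private
    module R = CommutativeRing R
    module A = Setoid A
    module B = Setoid B
    module V = Module V
    module FA = Free R A
    module FB = Free R B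

  extend₂ : FA.Expr → FB.Expr → V.Carrierᴹ
  extend₂ u v = FA.extend V (λ x → FB.extend V (f x) v) u

  module _ (f-cong : ∀ {x x′ y y′} → x A.≈ x′ → y B.≈ y′ → f x y V.≈ᴹ f x′ y′) where

    private
      congˡ : ∀ {x x′} → x A.≈ x′ → ∀ v → FB.extend V (f x) v V.≈ᴹ FB.extend V (f x′) v
      congˡ x≈x′ (FB.basis y)  = f-cong x≈x′ B.refl
      congˡ x≈x′ FB.𝟘          = V.≈ᴹ-refl
      congˡ x≈x′ (v FB.⊕ v′) = V.+ᴹ-cong (congˡ x≈x′ v) (congˡ x≈x′ v′)
      congˡ x≈x′ (r FB.⊙ v)  = V.*ₗ-cong R.refl (congˡ x≈x′ v)

      congʳ : ∀ u {v v′} → v FB.≋ v′ → extend₂ u v V.≈ᴹ extend₂ u v′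
      congʳ (FA.basis x) v≋v′ = FB.extend-cong V (f x) (f-cong A.refl) v≋v′
      congʳ FA.𝟘 v≋v′         = V.≈ᴹ-refl
      congʳ (u FA.⊕ u′) v≋v′  = V.+ᴹ-cong (congʳ u v≋v′) (congʳ u′ v≋v′)
      congʳ (r FA.⊙ u) v≋v′   = V.*ₗ-cong R.refl (congʳ u v≋v′)

    extend₂-cong : ∀ {u u′ v v′} → u FA.≋ u′ → v FB.≋ v′ → extend₂ u v V.≈ᴹ extend₂ u′ v′
    extend₂-cong {u′ = u′} {v} u≋u′ v≋v′ =
      V.≈ᴹ-trans (FA.extend-cong V (λ x → FB.extend V (f x) v) (λ x≈x′ → congˡ x≈x′ v) u≋u′)
                 (congʳ u′ v≋v′)

  extend₂-distribˡ : ∀ u v v′ → extend₂ u (v FB.⊕ v′) V.≈ᴹ extend₂ u v V.+ᴹ extend₂ u v′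
  extend₂-distribˡ (FA.basis x) v v′ = V.≈ᴹ-refl
  extend₂-distribˡ FA.𝟘 v v′         = V.≈ᴹ-sym (V.+ᴹ-identityˡ _)
  extend₂-distribˡ (u FA.⊕ u′) v v′  =
    V.≈ᴹ-trans (V.+ᴹ-cong (extend₂-distribˡ u v v′) (extend₂-distribˡ u′ v v′))
    (V.≈ᴹ-trans (V.+ᴹ-assoc _ _ _)
    (V.≈ᴹ-trans (V.+ᴹ-congˡ (V.≈ᴹ-sym (V.+ᴹ-assoc _ _ _)))
    (V.≈ᴹ-trans (V.+ᴹ-congˡ (V.+ᴹ-congʳ (V.+ᴹ-comm _ _)))
    (V.≈ᴹ-trans (V.+ᴹ-congˡ (V.+ᴹ-assoc _ _ _))
                (V.≈ᴹ-sym (V.+ᴹ-assoc _ _ _))))))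
  extend₂-distribˡ (r FA.⊙ u) v v′   =
    V.≈ᴹ-trans (V.*ₗ-cong R.refl (extend₂-distribˡ u v v′)) (V.*ₗ-distribˡ _ _ _)

  extend₂-*ʳ : ∀ r u v → extend₂ u (r FB.⊙ v) V.≈ᴹ r V.*ₗ extend₂ u v
  extend₂-*ʳ r (FA.basis x) v = V.≈ᴹ-refl
  extend₂-*ʳ r FA.𝟘 v         = V.≈ᴹ-sym (V.*ₗ-zeroʳ r)
  extend₂-*ʳ r (u FA.⊕ u′) v  =
    V.≈ᴹ-trans (V.+ᴹ-cong (extend₂-*ʳ r u v) (extend₂-*ʳ r u′ v)) (V.≈ᴹ-sym (V.*ₗ-distribˡ _ _ _))
  extend₂-*ʳ r (r′ FA.⊙ u) v  =
    V.≈ᴹ-trans (V.*ₗ-cong R.refl (extend₂-*ʳ r u v))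
    (V.≈ᴹ-trans (V.≈ᴹ-sym (V.*ₗ-assoc r′ r _))
    (V.≈ᴹ-trans (V.*ₗ-cong (R.*-comm r′ r) V.≈ᴹ-refl) (V.*ₗ-assoc r r′ _)))

-- The structure carried by a nonsymmetric operad, with the bilinearity of the
-- partial compositions but without the associativity and unit axioms, on which
-- the notion of suboperad does not depend.
--
-- `component n` is the space of arity n + 1, so that composing arities n + 1
-- and m + 1 lands in arity (n + 1) + (m + 1) - 1 = (n + m) + 1. The index
-- i : Fin (suc n) stands for the input number toℕ i + 1.

record PreOperad (R : CommutativeRing c ℓ) m ℓm : Set (c ⊔ ℓ ⊔ lsuc (m ⊔ ℓm)) where
  open CommutativeRing R using () renaming (Carrier to Scalar)
  field
    component : ℕ → Module R m ℓm

  module Component (n : ℕ) = Module (component n)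
  private
    module C {n : ℕ} = Module (component n)
  open C using (_≈ᴹ_; _+ᴹ_; _*ₗ_)

  ∣_∣ : ℕ → Set m
  ∣ n ∣ = Component.Carrierᴹ n

  infixl 7 _∘⟨_⟩_
  field
    unit       : ∣ 0 ∣
    _∘⟨_⟩_     : ∀ {n m} → ∣ n ∣ → Fin (suc n) → ∣ m ∣ → ∣ n + m ∣
    ∘-cong     : ∀ {n m} i {u u′ : ∣ n ∣} {v v′ : ∣ m ∣} →
                 u ≈ᴹ u′ → v ≈ᴹ v′ → u ∘⟨ i ⟩ v ≈ᴹ u′ ∘⟨ i ⟩ v′
    ∘-distribʳ : ∀ {n m} i (u u′ : ∣ n ∣) (v : ∣ m ∣) →
                 (u +ᴹ u′) ∘⟨ i ⟩ v ≈ᴹ u ∘⟨ i ⟩ v +ᴹ u′ ∘⟨ i ⟩ v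
    ∘-distribˡ : ∀ {n m} i (u : ∣ n ∣) (v v′ : ∣ m ∣) →
                 u ∘⟨ i ⟩ (v +ᴹ v′) ≈ᴹ u ∘⟨ i ⟩ v +ᴹ u ∘⟨ i ⟩ v′
    ∘-*ˡ       : ∀ {n m} i r (u : ∣ n ∣) (v : ∣ m ∣) →
                 (r *ₗ u) ∘⟨ i ⟩ v ≈ᴹ r *ₗ (u ∘⟨ i ⟩ v)
    ∘-*ʳ       : ∀ {n m} i r (u : ∣ n ∣) (v : ∣ m ∣) →
                 u ∘⟨ i ⟩ (r *ₗ v) ≈ᴹ r *ₗ (u ∘⟨ i ⟩ v)

module _ {R : CommutativeRing c ℓ} (O : PreOperad R m ℓm) where
  open PreOperad O

  record IsSuboperad (P : ∀ n → Pred ∣ n ∣ s) : Set (c ⊔ m ⊔ ℓm ⊔ s) where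
    field
      isSubspace  : ∀ n → IsSubspace (component n) (P n)
      unit-closed : unit ∈ P 0
      ∘-closed    : ∀ {n m} {u : ∣ n ∣} {v : ∣ m ∣} i → u ∈ P n → v ∈ P m → u ∘⟨ i ⟩ v ∈ P (n + m)

-- Vertices are numbered 1, …, n + 1. The bounds are irrelevant, so an arc is
-- determined by its two ends.

record Arc (n : ℕ) : Set where
  constructor arc
  field
    source target  : ℕ
    .1≤source      : 1 ≤ source
    .source<target : source < target
    .target≤1+n    : target ≤ suc n

open Arc public using (source; target)

IsBase : ∀ {n} → Arc n → Set
IsBase {n} α = source α ≡ 1 × target α ≡ suc n

IsEdge : ∀ {n} → Arc n → Set
IsEdge α = target α ≡ suc (source α) × ¬ IsBase α

IsDiagonal : ∀ {n} → Arc n → Set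
IsDiagonal α = ¬ IsBase α × ¬ IsEdge α

baseArc : ∀ n → Arc (suc n)
baseArc n = arc 1 (suc (suc n)) ≤-refl (s≤s (s≤s z≤n)) ≤-refl

-- The arc (i + 1, i + 2), since elements of Fin are counted from 0.
sideArc : ∀ {n} → Fin n → Arc n
sideArc i = arc (suc (toℕ i)) (suc (suc (toℕ i))) (s≤s z≤n) ≤-refl (s≤s (toℕ<n i))

-- The position of an arc (x , y) of a composition p ∘ᵢ q, where m is the
-- arity of q. The cases are mutually exclusive when 1 ≤ m and x < y.

data Position (i m x y : ℕ) : Set where
  before   : y ≤ i → Position i m x y
  around   : x ≤ i → i + m ≤ y → ¬ (x ≡ i × y ≡ i + m) → Position i m x y
  after    : i + m ≤ x → Position i m x y
  inside   : i ≤ x → y ≤ i + m → ¬ (x ≡ i × y ≡ i + m) → Position i m x y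
  glued    : x ≡ i → y ≡ i + m → Position i m x y
  crossing : ¬ (y ≤ i) → ¬ (x ≤ i × i + m ≤ y) → ¬ (i + m ≤ x) → ¬ (i ≤ x × y ≤ i + m) →
             Position i m x y

position : ∀ i m x y → Position i m x y
position i m x y with y ≤? i
... | yes y≤i = before y≤i
... | no  y≰i with i + m ≤? x
...   | yes i+m≤x = after i+m≤x
...   | no  i+m≰x with (x ≟ i) ×-dec (y ≟ i + m)
...     | yes (x≡i , y≡i+m) = glued x≡i y≡i+m
...     | no  ≢ with (x ≤? i) ×-dec (i + m ≤? y)
...       | yes (x≤i , i+m≤y) = around x≤i i+m≤y ≢
...       | no  ¬around with (i ≤? x) ×-dec (y ≤? i + m)
...         | yes (i≤x , y≤i+m) = inside i≤x y≤i+m ≢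
...         | no  ¬inside       = crossing y≰i ¬around i+m≰x ¬inside

module Cliques (M : UnitalMagma a ℓa) where
  open UnitalMagma M renaming (Carrier to Label; _∙_ to _⋆_)

  -- In arity 1 the only clique is the one labelled by the unit.
  record Clique (n : ℕ) : Set (a ⊔ ℓa) where
    field
      label        : Arc n → Label
      arity1-label : n ≡ 1 → ∀ α → label α ≈ ε

  open Clique public

  cliqueSetoid : ℕ → Setoid (a ⊔ ℓa) ℓa
  cliqueSetoid n = record
    { Carrier       = Clique n
    ; _≈_           = λ p q → ∀ α → label p α ≈ label q α
    ; isEquivalence = record
      { refl  = λ α → refl
      ; sym   = λ p≈q α → sym (p≈q α)
      ; trans = λ p≈q q≈r α → trans (p≈q α) (q≈r α)
      }
    }

  𝐮 : Clique 1
  𝐮 = record { label = λ _ → ε ; arity1-label = λ _ _ → refl }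

  module _ {n m : ℕ} (p : Clique (suc n)) (i : Fin (suc n)) (q : Clique (suc m)) where

    private
      ı = suc (toℕ i)

      shift-bound : ∀ {y} → y ≤ suc (suc (n + m)) → suc (y ∸ suc m) ≤ suc (suc n)
      shift-bound {y} y≤ = s≤s (m≤n+o⇒m∸n≤o y (suc m) (≤-trans y≤ (≤-reflexive
        (≡.trans (≡.cong (λ k → suc (suc k)) (+-comm n m)) (≡.cong suc (≡.sym (+-suc m n)))))))

    composeLabel : (α : Arc (suc (n + m))) → Position ı (suc m) (source α) (target α) → Label
    composeLabel (arc x y 1≤x x<y y≤) (before y≤i) =
      label p (arc x y 1≤x x<y (≤-trans y≤i (≤-trans (toℕ<n i) (n≤1+n _))))
    composeLabel (arc x y 1≤x x<y y≤) (around x≤i i+m≤y _) =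
      label p (arc x (suc (y ∸ suc m)) 1≤x
        (s≤s (≤-trans x≤i (m+n≤o⇒m≤o∸n ı i+m≤y)))
        (shift-bound y≤))
    composeLabel (arc x y 1≤x x<y y≤) (after i+m≤x) =
      label p (arc (suc (x ∸ suc m)) (suc (y ∸ suc m)) (s≤s z≤n)
        (s≤s (∸-monoˡ-< x<y (≤-trans (m≤n+m (suc m) ı) i+m≤x)))
        (shift-bound y≤))
    composeLabel (arc x y 1≤x x<y y≤) (inside i≤x y≤i+m _) =
      label q (arc (suc (x ∸ ı)) (suc (y ∸ ı)) (s≤s z≤n)
        (s≤s (∸-monoˡ-< x<y i≤x))
        (s≤s (m≤n+o⇒m∸n≤o y ı y≤i+m)))
    composeLabel _ (glued _ _) = label p (sideArc i) ⋆ label q (baseArc m)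
    composeLabel _ (crossing _ _ _ _) = ε

  composeLabel-arity1 : ∀ {n m} (p : Clique (suc n)) i (q : Clique (suc m)) → suc (n + m) ≡ 1 →
                        ∀ α pos → composeLabel p i q α pos ≈ ε
  composeLabel-arity1 {zero} {zero} p i q _ α (before _)         = arity1-label p ≡.refl _
  composeLabel-arity1 {zero} {zero} p i q _ α (around _ _ _)     = arity1-label p ≡.refl _
  composeLabel-arity1 {zero} {zero} p i q _ α (after _)          = arity1-label p ≡.refl _
  composeLabel-arity1 {zero} {zero} p i q _ α (inside _ _ _)     = arity1-label q ≡.refl _
  composeLabel-arity1 {zero} {zero} p i q _ α (glued _ _)        =
    trans (∙-cong (arity1-label p ≡.refl _) (arity1-label q ≡.refl _)) (identityˡ ε)
  composeLabel-arity1 {zero} {zero} p i q _ α (crossing _ _ _ _) = refl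

  compose : ∀ {n m} → Clique (suc n) → Fin (suc n) → Clique (suc m) → Clique (suc (n + m))
  compose {n} {m} p i q = record
    { label        = λ α → composeLabel p i q α (pos α)
    ; arity1-label = λ eq α → composeLabel-arity1 p i q eq α (pos α)
    }
    where
    pos : (α : Arc (suc (n + m))) → Position (suc (toℕ i)) (suc m) (source α) (target α)
    pos α = position (suc (toℕ i)) (suc m) (source α) (target α)

  compose-cong : ∀ {n m} i {p p′ : Clique (suc n)} {q q′ : Clique (suc m)} →
                 (∀ α → label p α ≈ label p′ α) → (∀ α → label q α ≈ label q′ α) →
                 ∀ α → label (compose p i q) α ≈ label (compose p′ i q′) α
  compose-cong {m = m} i {p} {p′} {q} {q′} p≈p′ q≈q′ α =
    go α (position (suc (toℕ i)) (suc m) (source α) (target α))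
    where
    go : ∀ α pos → composeLabel p i q α pos ≈ composeLabel p′ i q′ α pos
    go α (before _)         = p≈p′ _
    go α (around _ _ _)     = p≈p′ _
    go α (after _)          = p≈p′ _
    go α (inside _ _ _)     = q≈q′ _
    go α (glued _ _)        = ∙-cong (p≈p′ _) (q≈q′ _)
    go α (crossing _ _ _ _) = refl

module _ (K : HeytingField c ℓ ℓ#) (M : UnitalMagma a ℓa) where
  open UnitalMagma M using () renaming (Carrier to Label)
  open Cliques M

  private
    R = commutativeRing K
    module F (n : ℕ) = Free R (cliqueSetoid (suc n))
    module ∘-Bilinear {n m : ℕ} (i : Fin (suc n)) =
      Bilinear R (cliqueSetoid (suc n)) (cliqueSetoid (suc m)) (F.freeModule (n + m))
        (λ p q → F.basis {n + m} (compose p i q))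

  C : PreOperad R (c ⊔ a ⊔ ℓa) (c ⊔ ℓ ⊔ a ⊔ ℓa)
  C = record
    { component  = F.freeModule
    ; unit       = F.basis 𝐮
    ; _∘⟨_⟩_     = λ u i v → ∘-Bilinear.extend₂ i u v
    ; ∘-cong     = λ i → ∘-Bilinear.extend₂-cong i
        λ {p} {p′} {q} {q′} p≈p′ q≈q′ → F.basis-cong (compose-cong i {p} {p′} {q} {q′} p≈p′ q≈q′)
    ; ∘-distribʳ = λ i u u′ v → F.≋-refl
    ; ∘-distribˡ = λ i → ∘-Bilinear.extend₂-distribˡ i
    ; ∘-*ˡ       = λ i r u v → F.≋-refl
    ; ∘-*ʳ       = λ i → ∘-Bilinear.extend₂-*ʳ i
    }

  module _ (B : Pred Label b) (E : Pred Label e) (D : Pred Label d) where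

    HasLabels : ∀ {n} → Clique n → Set (b ⊔ e ⊔ d)
    HasLabels p = (∀ α → IsBase α → label p α ∈ B)
                × (∀ α → IsEdge α → label p α ∈ E)
                × (∀ α → IsDiagonal α → label p α ∈ D)

    Lab : ∀ n → Pred (PreOperad.∣_∣ C n) (c ⊔ ℓ ⊔ a ⊔ ℓa ⊔ b ⊔ e ⊔ d)
    Lab n = Span (F.freeModule n) λ v → ∃[ p ] HasLabels p × v ≡ F.basis p

ProductSet : (M : UnitalMagma a ℓa) → let open UnitalMagma M in
             Pred Carrier b → Pred Carrier e → Pred Carrier (a ⊔ ℓa ⊔ b ⊔ e)
ProductSet M X Y z = ∃[ x ] ∃[ y ] x ∈ X × y ∈ Y × z ≈ x ∙ y
  where open UnitalMagma M

{-# OPTIONS --safe #-}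
module Submission where

-- Both halves of the argument are elementary. Linearly, a span is a subspace,
-- and it is the least one containing its generators; since partial composition
-- is linear in each argument, the span of a family of generators is a
-- suboperad as soon as the generators include the unit and are closed under
-- partial composition (`Span-isSuboperad`).
--
-- It remains to see that the labelling condition on cliques is stable under
-- composition (`compose-hasLabels`). Let m be the arity of q. Apart from the
-- glued arc (i , i + m) and the crossing arcs, each arc of p ∘ᵢ q comes from an
-- arc of p or of q of the same kind (base, edge or diagonal), with the same
-- label. A crossing arc is a diagonal labelled by the unit, which lies in D.
-- The glued arc is labelled by pᵢ ⋆ q₀ and there are three cases:
--   * it is the base only if p has arity 1, when pᵢ is the unit and the label
--     is q₀, an element of B;
--   * it is an edge only if q has arity 1, when q₀ is the unit and the label
--     is pᵢ, an element of E;
--   * otherwise it is a diagonal, pᵢ is the label of an edge of p, and the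
--     label lies in E ⋆ B, hence in D.

open import Defs
open import Level using (Level)
open import Algebra.Apartness.Bundles using (HeytingField)
open import Algebra.Bundles using (CommutativeRing; UnitalMagma)
open import Algebra.Module.Bundles using (Module)
open import Data.Empty using (⊥-elim; ⊥-elim-irr)
open import Data.Fin.Base using (Fin; toℕ)
open import Data.Fin.Properties using (toℕ<n)
open import Data.List.Base using (List; []; _∷_; _++_; map)
open import Data.List.Relation.Unary.All using (All; []; _∷_)
open import Data.List.Relation.Unary.All.Properties using (map⁺; ++⁺)
open import Data.Nat.Base using (ℕ; zero; suc; _+_; _∸_; _≤_; z≤n; s≤s; s≤s⁻¹; z<s)
open import Data.Nat.Properties
open import Data.Product.Base using (_×_; _,_; proj₁; proj₂)
open import Relation.Binary.Definitions using (_Respects_)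
open import Relation.Binary.PropositionalEquality as ≡ using (_≡_)
open import Relation.Nullary.Negation.Core using (¬_)
open import Relation.Unary using (Pred; _∈_; _⊆_)

private
  variable
    c ℓ ℓ# a ℓa b e d m ℓm m′ ℓm′ s t : Level

-- Spans and subspaces

module _ {R : CommutativeRing c ℓ} (V : Module R m ℓm) where
  open CommutativeRing R using (_*_) renaming (Carrier to Scalar)
  open Module V

  linearCombination-++ : ∀ ts ts′ → linearCombination V (ts ++ ts′) ≈ᴹ
                                    linearCombination V ts +ᴹ linearCombination V ts′
  linearCombination-++ []             ts′ = ≈ᴹ-sym (+ᴹ-identityˡ _)
  linearCombination-++ ((r , v) ∷ ts) ts′ =
    ≈ᴹ-trans (+ᴹ-congˡ (linearCombination-++ ts ts′)) (≈ᴹ-sym (+ᴹ-assoc _ _ _))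

  -- Multiply all the coefficients of a formal linear combination by r.
  scaleTerms : Scalar → List (Scalar × Carrierᴹ) → List (Scalar × Carrierᴹ)
  scaleTerms r = map (λ (r′ , v) → r * r′ , v)

  linearCombination-scale : ∀ r ts → linearCombination V (scaleTerms r ts) ≈ᴹ
                                     r *ₗ linearCombination V ts
  linearCombination-scale r []              = ≈ᴹ-sym (*ₗ-zeroʳ r)
  linearCombination-scale r ((r′ , v) ∷ ts) =
    ≈ᴹ-trans (+ᴹ-cong (*ₗ-assoc r r′ v) (linearCombination-scale r ts))
             (≈ᴹ-sym (*ₗ-distribˡ r _ _))

  Span-isSubspace : (S : Pred Carrierᴹ s) → IsSubspace V (Span V S)
  Span-isSubspace S = record
    { resp-≈   = λ { u≈v (ts , S-ts , u≈) → ts , S-ts , ≈ᴹ-trans (≈ᴹ-sym u≈v) u≈ }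
    ; 0-closed = [] , [] , ≈ᴹ-refl
    ; +-closed = λ { (ts , S-ts , u≈) (ts′ , S-ts′ , v≈) →
        ts ++ ts′ , ++⁺ S-ts S-ts′ ,
        ≈ᴹ-trans (+ᴹ-cong u≈ v≈) (≈ᴹ-sym (linearCombination-++ ts ts′)) }
    ; *-closed = λ { r (ts , S-ts , v≈) →
        scaleTerms r ts , map⁺ S-ts ,
        ≈ᴹ-trans (*ₗ-cong (CommutativeRing.refl R) v≈)
                 (≈ᴹ-sym (linearCombination-scale r ts)) }
    }

  ⊆Span : {S : Pred Carrierᴹ s} → S ⊆ Span V S
  ⊆Span {x = v} v∈S =
    (CommutativeRing.1# R , v) ∷ [] , v∈S ∷ [] ,
    ≈ᴹ-sym (≈ᴹ-trans (+ᴹ-identityʳ _) (*ₗ-identityˡ v))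

  Span-least : {S : Pred Carrierᴹ s} {P : Pred Carrierᴹ t} →
               IsSubspace V P → S ⊆ P → Span V S ⊆ P
  Span-least {S = S} {P} P-sub S⊆P (ts , S-ts , u≈) = resp-≈ (≈ᴹ-sym u≈) (go S-ts)
    where
    open IsSubspace P-sub
    go : ∀ {ts} → All (λ t → proj₂ t ∈ S) ts → linearCombination V ts ∈ P
    go []         = 0-closed
    go (v∈S ∷ vs) = +-closed (*-closed _ (S⊆P v∈S)) (go vs)

-- The three hypotheses on f say that it is a linear map.
preimage-isSubspace :
  {R : CommutativeRing c ℓ} (V : Module R m ℓm) (W : Module R m′ ℓm′) →
  let module V = Module V
      module W = Module W in
  (f : V.Carrierᴹ → W.Carrierᴹ) →
  (∀ {u v} → u V.≈ᴹ v → f u W.≈ᴹ f v) →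
  (∀ u v → f (u V.+ᴹ v) W.≈ᴹ f u W.+ᴹ f v) →
  (∀ r v → f (r V.*ₗ v) W.≈ᴹ r W.*ₗ f v) →
  {P : Pred W.Carrierᴹ s} → IsSubspace W P → IsSubspace V (λ v → f v ∈ P)
preimage-isSubspace V W f f-cong f-+ f-* P-sub = record
  { resp-≈   = λ u≈v → resp-≈ (f-cong u≈v)
    -- f 0 = f (0 · 0) = 0 · f 0 = 0
  ; 0-closed = resp-≈ (W.≈ᴹ-sym (W.≈ᴹ-trans (f-cong (V.≈ᴹ-sym (V.*ₗ-zeroˡ V.0ᴹ)))
                                (W.≈ᴹ-trans (f-* _ _) (W.*ₗ-zeroˡ _))))
                      0-closed
  ; +-closed = λ u∈ v∈ → resp-≈ (W.≈ᴹ-sym (f-+ _ _)) (+-closed u∈ v∈)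
  ; *-closed = λ r v∈ → resp-≈ (W.≈ᴹ-sym (f-* r _)) (*-closed r v∈)
  }
  where
  module V = Module V
  module W = Module W
  open IsSubspace P-sub

Span-isSuboperad :
  {R : CommutativeRing c ℓ} (O : PreOperad R m ℓm) → let open PreOperad O in
  (S : ∀ n → Pred ∣ n ∣ s) → unit ∈ S 0 →
  (∀ {n m} {u : ∣ n ∣} {v : ∣ m ∣} i → u ∈ S n → v ∈ S m → u ∘⟨ i ⟩ v ∈ S (n + m)) →
  IsSuboperad O (λ n → Span (component n) (S n))
Span-isSuboperad O S unit∈S ∘∈S = record
  { isSubspace  = λ n → Span-isSubspace (component n) (S n)
  ; unit-closed = ⊆Span (component 0) unit∈S
  ; ∘-closed    = λ {n} {m} {u} {v} i u∈ v∈ →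
      Span-least (component n)
        (preimage-isSubspace (component n) (component (n + m)) (λ u → u ∘⟨ i ⟩ v)
          (λ u≈u′ → ∘-cong i u≈u′ (Component.≈ᴹ-refl m))
          (λ u u′ → ∘-distribʳ i u u′ v) (λ r u → ∘-*ˡ i r u v)
          (Span-isSubspace (component (n + m)) (S (n + m))))
        (λ {u} u∈S → Span-least (component m)
          (preimage-isSubspace (component m) (component (n + m)) (λ v → u ∘⟨ i ⟩ v)
            (∘-cong i (Component.≈ᴹ-refl n))
            (∘-distribˡ i u) (λ r → ∘-*ʳ i r u)
            (Span-isSubspace (component (n + m)) (S (n + m))))
          (λ v∈S → ⊆Span (component (n + m)) (∘∈S i u∈S v∈S))
          v∈)
        u∈
  }
  where open PreOperad O

-- Arcs of a composite clique

-- A nonzero truncated difference is a true difference.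
∸≡suc⇒≡+suc : ∀ y k {z} → y ∸ k ≡ suc z → y ≡ k + suc z
∸≡suc⇒≡+suc y       zero    eq = eq
∸≡suc⇒≡+suc (suc y) (suc k) eq = ≡.cong suc (∸≡suc⇒≡+suc y k eq)

∸≡suc∸⇒≡suc : ∀ {x y k} → k ≤ x → y ∸ k ≡ suc (x ∸ k) → y ≡ suc x
∸≡suc∸⇒≡suc {x} {y} {k} k≤x eq = ≡.trans (∸≡suc⇒≡+suc y k eq)
  (≡.trans (+-suc k (x ∸ k)) (≡.cong suc (m+[n∸m]≡n k≤x)))

-- An arc whose target is at most the gluing input misses the last vertex of p,
-- so it is not the base of p.
before⇒¬last : ∀ {n y} (i : Fin (suc n)) → y ≤ suc (toℕ i) → ¬ (y ≡ suc (suc n))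
before⇒¬last i y≤ı ≡.refl = <-irrefl ≡.refl (≤-trans y≤ı (toℕ<n i))

-- In the following lemmas, x and y are the ends of an arc of the composite, in
-- arity n + m + 1, of cliques of arities n + 1 and m + 1 at the input
-- toℕ i + 1, written ı; p and q are the left and right factors.
module _ {n m : ℕ} (i : Fin (suc n)) where
  private
    ı : ℕ
    ı = suc (toℕ i)

  gluing-bound : ı + suc m ≤ suc (suc (n + m))
  gluing-bound = ≤-trans (+-monoˡ-≤ (suc m) (toℕ<n i)) (≤-reflexive (≡.cong suc (+-suc n m)))

  -- An arc around the gluing position that ends at the last vertex of p ends at
  -- the last vertex of the composite.
  around-last : ∀ {y} → y ∸ suc m ≡ suc n → y ≡ suc (suc (n + m))
  around-last {y} eq = ≡.trans (∸≡suc⇒≡+suc y (suc m) eq)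
    (≡.cong suc (+-comm m (suc n)))

  -- An arc around the gluing position that p sees as a side is the glued arc.
  around-side : ∀ {x y} → x ≤ ı → ı + suc m ≤ y → y ∸ suc m ≡ x → x ≡ ı × y ≡ ı + suc m
  around-side {x} {y} x≤ı ı+m≤y eq = x≡ı , ≡.trans y≡ (≡.cong (_+ suc m) x≡ı)
    where
    y≡ : y ≡ x + suc m
    y≡ = ≡.trans (≡.sym (m∸n+n≡m (m+n≤o⇒n≤o ı ı+m≤y))) (≡.cong (_+ suc m) eq)
    x≡ı : x ≡ ı
    x≡ı = ≤-antisym x≤ı (+-cancelʳ-≤ (suc m) ı x (≤-trans ı+m≤y (≤-reflexive y≡)))

  -- An edge of the composite around the gluing position is the glued arc.
  around-short : ∀ {x} → x ≤ ı → ı + suc m ≤ suc x → x ≡ ı × suc x ≡ ı + suc m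
  around-short {x} x≤ı ı+m≤y =
    ≤-antisym x≤ı (s≤s⁻¹ (≤-trans (m<m+n ı z<s) ı+m≤y)) ,
    ≤-antisym (≤-trans (s≤s x≤ı) (m<m+n ı z<s)) ı+m≤y

  -- An arc after the gluing position comes from an arc of p that misses the
  -- first vertex, hence is not the base of p.
  after⇒¬first : ∀ {x} → ı + suc m ≤ x → ¬ (suc (x ∸ suc m) ≡ 1)
  after⇒¬first {x} ı+m≤x eq =
    m+n≮n (toℕ i) (suc m) (≤-trans ı+m≤x (m∸n≡0⇒m≤n (suc-injective eq)))

  -- An arc inside the gluing position that q sees as its base is the glued arc.
  inside-base : ∀ {x y} → ı ≤ x → suc (x ∸ ı) ≡ 1 × suc (y ∸ ı) ≡ suc (suc m) →
                x ≡ ı × y ≡ ı + suc m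
  inside-base {x} {y} ı≤x (first , last) =
    ≤-antisym (m∸n≡0⇒m≤n (suc-injective first)) ı≤x , ∸≡suc⇒≡+suc y ı (suc-injective last)

  -- If (i , i + 1) is the base of p, then p has arity 1 and the glued arc is
  -- the base of the composite.
  glued-side : (α : Arc (suc (n + m))) → source α ≡ ı → target α ≡ ı + suc m →
               ¬ IsBase α → IsEdge (sideArc i)
  glued-side α x≡ y≡ ¬base = ≡.refl , λ { (first , last) → ¬base
    ( ≡.trans x≡ first
    , ≡.trans y≡ (≡.trans (≡.cong (_+ suc m) (suc-injective last)) (≡.cong suc (+-suc n m)))) }

-- Labels of a composite clique

module _ (K : HeytingField c ℓ ℓ#) (M : UnitalMagma a ℓa) where
  open UnitalMagma M renaming (Carrier to Label)
  open Cliques M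

  module _
    (B : Pred Label b) (E : Pred Label e) (D : Pred Label d)
    (B-resp : B Respects _≈_) (E-resp : E Respects _≈_) (D-resp : D Respects _≈_)
    (ε∈B : ε ∈ B) (ε∈D : ε ∈ D) (E⋆B⊆D : ProductSet M E B ⊆ D)
    where

    𝐮-hasLabels : HasLabels K M B E D 𝐮
    𝐮-hasLabels = (λ _ _ → ε∈B) , (λ α α-edge → ⊥-elim (noEdge α α-edge)) , (λ _ _ → ε∈D)
      where
      noEdge : (α : Arc 1) → ¬ IsEdge α
      noEdge (arc zero          _ () _ _)
      noEdge (arc (suc zero)    _ _ _ _) (≡.refl , ¬base) = ¬base (≡.refl , ≡.refl)
      noEdge (arc (suc (suc x)) _ _ _ y≤2) (≡.refl , _) = ⊥-elim-irr (m+n≮m 2 x y≤2)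

    module _ {n m : ℕ} {p : Clique (suc n)} {q : Clique (suc m)} (i : Fin (suc n))
      (p-labels : HasLabels K M B E D p) (q-labels : HasLabels K M B E D q)
      where
      private
        ı : ℕ
        ı = suc (toℕ i)

        p-base : ∀ α → IsBase α → label p α ∈ B
        p-base = proj₁ p-labels

        p-edge : ∀ α → IsEdge α → label p α ∈ E
        p-edge = proj₁ (proj₂ p-labels)

        p-diagonal : ∀ α → IsDiagonal α → label p α ∈ D
        p-diagonal = proj₂ (proj₂ p-labels)

        q-base : ∀ α → IsBase α → label q α ∈ B
        q-base = proj₁ q-labels

        q-edge : ∀ α → IsEdge α → label q α ∈ E
        q-edge = proj₁ (proj₂ q-labels)

        q-diagonal : ∀ α → IsDiagonal α → label q α ∈ D
        q-diagonal = proj₂ (proj₂ q-labels)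

      -- The position of the arc is an arbitrary argument in the next three lemmas,
      -- so that it can be split on without unfolding the decision procedure.
      compose-base : ∀ α (pos : Position ı (suc m) (source α) (target α)) → IsBase α →
                     composeLabel p i q α pos ∈ B
      compose-base (arc _ _ _ _ _) (before y≤ı) (≡.refl , ≡.refl) =
        ⊥-elim (m+n≮m n m (s≤s⁻¹ (≤-trans y≤ı (toℕ<n i))))
      compose-base (arc _ _ _ _ _) (around _ _ _) (≡.refl , ≡.refl) =
        p-base _ (≡.refl , ≡.cong suc (m+n∸n≡m (suc n) m))
      compose-base (arc _ _ _ _ _) (after ı+m≤x) (≡.refl , ≡.refl)
        with () ← ≤-trans (m≤n+m (suc m) (toℕ i)) (s≤s⁻¹ ı+m≤x)
      compose-base (arc _ _ _ _ _) (inside ı≤x y≤ı+m ¬glued) (≡.refl , ≡.refl) =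
        ⊥-elim (¬glued (≤-antisym (s≤s z≤n) ı≤x , ≤-antisym y≤ı+m (gluing-bound i)))
      -- Here p has arity 1, so the label of its only arc is the unit.
      compose-base (arc _ _ _ _ _) (glued 1≡ı y≡ı+m) (≡.refl , ≡.refl) =
        B-resp (sym (trans (∙-congʳ (arity1-label p 1+n≡1 _)) (identityˡ _)))
               (q-base _ (≡.refl , ≡.refl))
        where
        1+n≡1 : suc n ≡ 1
        1+n≡1 = ≡.trans
          (+-cancelʳ-≡ (suc m) (suc n) ı (≡.trans (≡.cong suc (+-suc n m)) y≡ı+m))
          (≡.sym 1≡ı)
      compose-base (arc _ _ _ _ _) (crossing _ ¬around _ _) (≡.refl , ≡.refl) =
        ⊥-elim (¬around (s≤s z≤n , gluing-bound i))

      compose-edge : ∀ α (pos : Position ı (suc m) (source α) (target α)) → IsEdge α →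
                     composeLabel p i q α pos ∈ E
      compose-edge (arc _ _ _ _ _) (before y≤ı) (≡.refl , _) =
        p-edge _ (≡.refl , λ (_ , last) → before⇒¬last i y≤ı last)
      compose-edge (arc _ _ _ _ _) (around x≤ı ı+m≤y ¬glued) (≡.refl , _) =
        ⊥-elim (¬glued (around-short i x≤ı ı+m≤y))
      compose-edge (arc _ _ _ _ _) (after ı+m≤x) (≡.refl , _) =
        p-edge _ ( ≡.cong suc (+-∸-assoc 1 (m+n≤o⇒n≤o ı ı+m≤x))
                 , λ (first , _) → after⇒¬first i ı+m≤x first)
      compose-edge (arc _ _ _ _ _) (inside ı≤x _ ¬glued) (≡.refl , _) =
        q-edge _ ( ≡.cong suc (+-∸-assoc 1 ı≤x)
                 , λ base → ¬glued (inside-base i ı≤x base))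
      -- Here q has arity 1, so the label of its only arc is the unit.
      compose-edge α@(arc _ _ _ _ _) (glued x≡ı y≡ı+m) (≡.refl , ¬base) =
        E-resp (sym (trans (∙-congˡ (arity1-label q 1+m≡1 _)) (identityʳ _)))
               (p-edge _ (glued-side i α x≡ı y≡ı+m ¬base))
        where
        1+m≡1 : suc m ≡ 1
        1+m≡1 = +-cancelˡ-≡ ı (suc m) 1
          (≡.trans (≡.sym y≡ı+m) (≡.trans (≡.cong suc x≡ı) (+-comm 1 ı)))
      compose-edge (arc _ _ _ _ _) (crossing y≰ı _ ı+m≰x ¬inside) (≡.refl , _) =
        ⊥-elim (¬inside (≮⇒≥ y≰ı , ≰⇒> ı+m≰x))

      compose-diagonal : ∀ α (pos : Position ı (suc m) (source α) (target α)) → IsDiagonal α →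
                         composeLabel p i q α pos ∈ D
      compose-diagonal (arc _ _ _ _ _) (before y≤ı) (¬base , ¬edge) =
        p-diagonal _ ( (λ (_ , last) → before⇒¬last i y≤ı last)
                     , λ (short , _) → ¬edge (short , ¬base))
      compose-diagonal (arc _ _ _ _ _) (around x≤ı ı+m≤y ¬glued) (¬base , _) =
        p-diagonal _ ( (λ (first , last) → ¬base (first , around-last i (suc-injective last)))
                     , λ (short , _) → ¬glued (around-side i x≤ı ı+m≤y (suc-injective short)))
      compose-diagonal (arc _ _ _ _ _) (after ı+m≤x) (¬base , ¬edge) =
        p-diagonal _ ( (λ (first , _) → after⇒¬first i ı+m≤x first)
                     , λ (short , _) → ¬edge
                         (∸≡suc∸⇒≡suc (m+n≤o⇒n≤o ı ı+m≤x) (suc-injective short) , ¬base))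
      compose-diagonal (arc _ _ _ _ _) (inside ı≤x _ ¬glued) (¬base , ¬edge) =
        q-diagonal _ ( (λ base → ¬glued (inside-base i ı≤x base))
                     , λ (short , _) → ¬edge
                         (∸≡suc∸⇒≡suc ı≤x (suc-injective short) , ¬base))
      compose-diagonal α@(arc _ _ _ _ _) (glued x≡ı y≡ı+m) (¬base , _) =
        E⋆B⊆D ( _ , _ , p-edge _ (glued-side i α x≡ı y≡ı+m ¬base)
              , q-base _ (≡.refl , ≡.refl) , refl)
      compose-diagonal (arc _ _ _ _ _) (crossing _ _ _ _) _ = ε∈D

      compose-hasLabels : HasLabels K M B E D (compose p i q)
      compose-hasLabels =
          (λ α → compose-base α (pos α))
        , (λ α → compose-edge α (pos α))
        , (λ α → compose-diagonal α (pos α))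
        where
        pos : (α : Arc (suc (n + m))) → Position ı (suc m) (source α) (target α)
        pos α = position ı (suc m) (source α) (target α)

proposition3p1p1 : ∀ {c ℓ ℓ# a ℓa b e d : Level}
    (K : HeytingField c ℓ ℓ#) → CharacteristicZero K →
    (M : UnitalMagma a ℓa) → let open UnitalMagma M in
    (B : Pred Carrier b) (E : Pred Carrier e) (D : Pred Carrier d) →
    B Respects _≈_ → E Respects _≈_ → D Respects _≈_ →
    ε ∈ B → ε ∈ D → ProductSet M E B ⊆ D →
    IsSuboperad (C K M) (Lab K M B E D)
proposition3p1p1 K _ M B E D B-resp E-resp D-resp ε∈B ε∈D E⋆B⊆D =
  Span-isSuboperad (C K M) _
    (𝐮 , 𝐮-hasLabels K M B E D B-resp E-resp D-resp ε∈B ε∈D E⋆B⊆D , ≡.refl)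
    λ { i (p , p-labels , ≡.refl) (q , q-labels , ≡.refl) →
        compose p i q ,
        compose-hasLabels K M B E D B-resp E-resp D-resp ε∈B ε∈D E⋆B⊆D i p-labels q-labels ,
        ≡.refl }
  where open Cliques M
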